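{- Let $n=p_1^{\alpha_1}\cdots p_k^{\alpha_k}$, where $k\geq 1$, $\alpha_i\geq 1$ and the $p_i$ are distinct primes satisfying $p_i\equiv 1\pmod 4$ for all $i=1,\ldots,k$. Then $\mathcal{K}_4(G_n)=0$ (that is, the Paley-type graph $G_n$ has no clique of order four) if and only if $p_i\in\{5,13,17\}$ for some $i\in\{1,\ldots,k\}$.
   Context: For $n=p_1^{\alpha_1}\cdots p_k^{\alpha_k}$ with distinct primes $p_i\equiv 1\pmod 4$ and $\alpha_i\ge 1$, let $\mathbb{Z}_n^\ast$ be the group of units of the ring $\mathbb{Z}_n=\mathbb{Z}/n\mathbb{Z}$. The Paley-type graph $G_n$ is the simple undirected graph with vertex set $\mathbb{Z}_n$ in which $xy$ is an edge if and only if $x-y\equiv a^2\pmod n$ for some $a\in\mathbb{Z}_n^\ast$ (this is symmetric since $-1$ is a square in $\mathbb{Z}_n^\ast$). For a graph $G$, $\mathcal{K}_m(G)$ denotes the number of cliques of order $m$ in $G$, i.e. the number of $m$-element sets of pairwise adjacent vertices. -}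

module Defs where

open import Data.Bool.Base using (true; false)
open import Data.Fin.Base using (Fin; toℕ)
open import Data.Fin.Properties using (any?; all?) renaming (_≟_ to _≟ᶠ_)
open import Data.Fin.Subset using (Subset; _∈_; ∣_∣)
open import Data.Fin.Subset.Properties using (_∈?_)
open import Data.Integer.Base using (ℤ; +_; 1ℤ; _-_; _*_)
open import Data.Integer.Divisibility.Signed using (_∣_; _∣?_)
open import Data.List.Base using (List; []; _∷_; [_]; _++_; map; filter; length)
open import Data.Nat.Base using (ℕ; zero; suc)
open import Data.Nat.Properties using (_≟_)
open import Data.Product.Base using (∃; _×_)
import Data.Vec.Base as Vec
open import Level using (0ℓ)
open import Relation.Binary.Core using (Rel)
open import Relation.Binary.Definitions using (Decidable)
open import Relation.Binary.PropositionalEquality.Core using (_≡_; _≢_)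
open import Relation.Nullary.Decidable using (_×-dec_; _→-dec_; ¬?)
open import Relation.Unary as Unary using (Pred)

-- The ring ℤ/nℤ is represented by the residues Fin n; identities in it are
-- congruences modulo n between integer representatives.

infix 4 _≡_[mod_]

_≡_[mod_] : ℤ → ℤ → ℕ → Set
a ≡ b [mod n ] = + n ∣ (a - b)

⟦_⟧ : ∀ {n} → Fin n → ℤ
⟦ x ⟧ = + toℕ x

IsUnit : ∀ {n} → Pred (Fin n) 0ℓ
IsUnit {n} a = ∃ λ (b : Fin n) → ⟦ a ⟧ * ⟦ b ⟧ ≡ 1ℤ [mod n ]

isUnit? : ∀ {n} → Unary.Decidable (IsUnit {n})
isUnit? {n} a = any? λ b → + n ∣? (⟦ a ⟧ * ⟦ b ⟧ - 1ℤ)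

-- Adjacency in the Paley-type graph; G n decides it.  For general n this
-- relation need not be symmetric; it is when every prime factor of n is
-- ≡ 1 (mod 4), as -1 is then the square of a unit.  It is irreflexive as soon
-- as n ≥ 2.

Paley : ∀ n → Rel (Fin n) 0ℓ
Paley n x y = ∃ λ (a : Fin n) → IsUnit a × (⟦ x ⟧ - ⟦ y ⟧ ≡ ⟦ a ⟧ * ⟦ a ⟧ [mod n ])

G : ∀ n → Decidable (Paley n)
G n x y = any? λ a → isUnit? a ×-dec (+ n ∣? (⟦ x ⟧ - ⟦ y ⟧ - ⟦ a ⟧ * ⟦ a ⟧))

module _ {n : ℕ} (_~_ : Rel (Fin n) 0ℓ) where

  -- Both orders of every pair are required, so no symmetry of _~_ is presumed.
  IsClique : Pred (Subset n) 0ℓ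
  IsClique S = ∀ x y → x ∈ S → y ∈ S → x ≢ y → x ~ y

  isClique? : Decidable _~_ → Unary.Decidable IsClique
  isClique? _~?_ S =
    all? λ x → all? λ y →
      (x ∈? S) →-dec ((y ∈? S) →-dec (¬? (x ≟ᶠ y) →-dec (x ~? y)))

-- Every subset of Fin n, listed exactly once.
subsets : ∀ n → List (Subset n)
subsets zero    = [ Vec.[] ]
subsets (suc n) = map (true Vec.∷_) (subsets n) ++ map (false Vec.∷_) (subsets n)

-- 𝒦 m G is the number of cliques of order m; a graph is given by its
-- (decidable) adjacency relation, so that cliques can be counted.
𝒦 : ∀ (m : ℕ) {n} {_~_ : Rel (Fin n) 0ℓ} → Decidable _~_ → ℕ
𝒦 m {n} {_~_} _~?_ =
  length (filter (λ S → (∣ S ∣ ≟ m) ×-dec isClique? _~_ _~?_ S) (subsets n))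

{-# OPTIONS --safe #-}
module Submission where

-- By the Chinese remainder theorem and Newton's iteration, G n has a clique of
-- order four iff, modulo each prime factor p of n, there are four integers whose
-- pairwise differences are squares of units.  Exhaustion excludes this for
-- p = 5, 13, 17.  Any other p ≡ 1 (mod 4) exceeds 20; colour the edges on
-- 0, …, 19 according to whether the difference is a square modulo p.  As
-- R(4,4) ≤ 20, some four of these integers span edges of a single colour, and
-- if that colour is "nonsquare", multiplication by a nonsquare turns all their
-- differences into squares.

open import Defs
open import Data.Bool.Base using (true; false)
open import Data.Fin.Base as Fin
  using (Fin; zero; suc; toℕ; fromℕ<; punchOut; combine; remQuot)
open import Data.Fin.Patterns using (0F; 1F; 2F; 3F)
open import Data.Fin.Properties
  using (all?; any?; combine-remQuot; pigeonhole; punchOut-injective; suc-injective; toℕ-fromℕ<;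
         toℕ-injective; toℕ<n; <⇒≢)
  renaming (_≟_ to _≟ᶠ_)
open import Data.Fin.Subset using (Subset; inside; outside; ⊥; ∣_∣; _∈_; _∉_)
open import Data.Fin.Subset.Properties using (∣⊥∣≡0; ∉⊥)
open import Data.Integer.Base as ℤ using (ℤ; +_; 0ℤ; 1ℤ; -1ℤ; _+_; _-_; -_; _*_)
open import Data.Integer.DivMod using (_%ℕ_; _/ℕ_; n%ℕd<d; a≡a%ℕn+[a/ℕn]*n)
open import Data.Integer.Divisibility.Signed as ℤ∣
  using (_∣_; _∣?_; divides; ∣m∣n⇒∣m+n; ∣m⇒∣-m; ∣n⇒∣m*n; ∣m⇒∣m*n)
import Data.Integer.Properties as ℤ
open import Data.Integer.Tactic.RingSolver using (solve-∀)
open import Data.List.Base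
  using (List; []; _∷_; _++_; applyUpTo; length; lookup; map; tabulate)
open import Data.List.Membership.Propositional using () renaming (_∈_ to _∈ˡ_)
open import Data.List.Membership.Propositional.Properties
  using (∈-++⁺ˡ; ∈-++⁺ʳ; ∈-filter⁺; ∈-length; ∈-lookup; ∈-map⁺; ∈-tabulate⁺; ∈-tabulate⁻; ∈-∃++)
open import Data.List.Properties using (filter-none; length-map; length-tabulate)
open import Data.List.Relation.Binary.Permutation.Propositional using (_↭_; ↭-sym; ↭⇒↭ₛ)
open import Data.List.Relation.Binary.Permutation.Propositional.Properties
  using (shift; ↭-length; ∈-resp-↭)
open import Data.List.Relation.Binary.Permutation.Setoid.Properties using (Unique-resp-↭)
open import Data.List.Relation.Binary.Sublist.Propositional
  using (_⊆_; []; _∷_; _∷ʳ_; ⊆-trans; minimum)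
open import Data.List.Relation.Binary.Sublist.Propositional.Properties using (All-resp-⊆)
open import Data.List.Relation.Unary.All as All using (All; []; _∷_)
import Data.List.Relation.Unary.All.Properties as All
open import Data.List.Relation.Unary.AllPairs as AllPairs using (AllPairs; []; _∷_)
import Data.List.Relation.Unary.AllPairs.Properties as AllPairs
open import Data.List.Relation.Unary.Any using (here; there)
open import Data.List.Relation.Unary.Unique.Propositional using (Unique)
import Data.List.Relation.Unary.Unique.Propositional.Properties as Unique
open import Data.Nat.Base as ℕ
  using (ℕ; zero; suc; z≤n; s≤s; NonZero; _≥_; _^_; _/_; _%_)
open import Data.Nat.Coprimality as Coprime using (Coprime; coprime-Bézout; prime⇒coprime)
import Data.Nat.Divisibility as ℕ
open import Data.Nat.DivMod using (m≡m%n+[m/n]*n)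
open import Data.Nat.GCD using (module Bézout)
open import Data.Nat.ListAction using (product)
open import Data.Nat.ListAction.Properties using (product≢0)
open import Data.Nat.Primality
  using (Prime; prime?; prime⇒irreducible; prime⇒nonTrivial; prime⇒nonZero; ¬prime[1])
import Data.Nat.Properties as ℕ
import Data.Nat.Tactic.RingSolver as ℕ-Solver
open import Data.Product.Base using (∃; ∃₂; _×_; _,_; proj₁; proj₂)
open import Data.Sum.Base using (_⊎_; inj₁; inj₂; [_,_]′)
open import Data.Vec.Base using ([]; _∷_; here; there; _[_]≔_)
open import Function.Base using (_∘_; id)
open import Function.Bundles using (_⇔_; mk⇔; module Equivalence)
open import Function.Definitions using (Injective)
open import Level using (0ℓ)
open import Relation.Binary.Core using (Rel)
open import Relation.Binary.Definitions using (Decidable; Symmetric)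
open import Relation.Binary.PropositionalEquality
open import Relation.Nullary.Decidable
  using (Dec; yes; no; decidable-stable; from-yes; map′; toSum; ¬?; _×-dec_; _⊎-dec_; _→-dec_)
open import Relation.Nullary.Negation using (¬_; contradiction)
open import Relation.Unary using (Pred; _∪_)

-- Congruences, unit squares and cliques modulo m

-- Vertices, roots and inverses are arbitrary integers, so that one tuple can be reduced, lifted and
-- glued across moduli; residues appear only where `Paley` is met. A difference that is a unit stays
-- nonzero modulo every prime factor, which is why a clique modulo n keeps its vertices distinct
-- modulo p. The number 20 is the binomial coefficient C(6,3), the Erdős-Szekeres bound. The primes
-- below it that are 1 modulo 4 are exactly 5, 13 and 17, so the Ramsey argument takes over just
-- where the exhaustive search stops. The colouring rests on two facts about squares modulo p = 2h +
-- 1: a product of two nonsquares is a square, and -1 is a square. Both come from counting with 1,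
-- ..., h, the residues up to sign, instead of from a primitive root.

infix 4 _≈[_]_

-- Unlike the definition it wraps, the record is injective in a and b, so that
-- they can be inferred.
record _≈[_]_ (a : ℤ) (m : ℕ) (b : ℤ) : Set where
  constructor congruent
  field divisible : a ≡ b [mod m ]

open _≈[_]_

module _ {m : ℕ} where

  ≈-reflexive : ∀ {a b} → a ≡ b → a ≈[ m ] b
  ≈-reflexive {a} refl = congruent (subst (+ m ∣_) (sym (ℤ.+-inverseʳ a)) (divides 0ℤ refl))

  ≈-refl : ∀ {a} → a ≈[ m ] a
  ≈-refl = ≈-reflexive refl

  ≈-sym : ∀ {a b} → a ≈[ m ] b → b ≈[ m ] a
  ≈-sym {a} {b} (congruent p) = congruent (subst (+ m ∣_) (identity a b) (∣m⇒∣-m p))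
    where
    identity : ∀ a b → - (a - b) ≡ b - a
    identity = solve-∀

  ≈-trans : ∀ {a b c} → a ≈[ m ] b → b ≈[ m ] c → a ≈[ m ] c
  ≈-trans {a} {b} {c} (congruent p) (congruent q) =
    congruent (subst (+ m ∣_) (identity a b c) (∣m∣n⇒∣m+n p q))
    where
    identity : ∀ a b c → (a - b) + (b - c) ≡ a - c
    identity = solve-∀

  ≈-+ : ∀ {a b c d} → a ≈[ m ] b → c ≈[ m ] d → a + c ≈[ m ] b + d
  ≈-+ {a} {b} {c} {d} (congruent p) (congruent q) =
    congruent (subst (+ m ∣_) (identity a b c d) (∣m∣n⇒∣m+n p q))
    where
    identity : ∀ a b c d → (a - b) + (c - d) ≡ (a + c) - (b + d)
    identity = solve-∀

  ≈-neg : ∀ {a b} → a ≈[ m ] b → - a ≈[ m ] - b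
  ≈-neg {a} {b} (congruent p) = congruent (subst (+ m ∣_) (identity a b) (∣m⇒∣-m p))
    where
    identity : ∀ a b → - (a - b) ≡ - a - - b
    identity = solve-∀

  ≈-* : ∀ {a b c d} → a ≈[ m ] b → c ≈[ m ] d → a * c ≈[ m ] b * d
  ≈-* {a} {b} {c} {d} (congruent p) (congruent q) =
    congruent (subst (+ m ∣_) (identity a b c d) (∣m∣n⇒∣m+n (∣m⇒∣m*n c p) (∣n⇒∣m*n b q)))
    where
    identity : ∀ a b c d → (a - b) * c + b * (c - d) ≡ a * c - b * d
    identity = solve-∀

  ≈-- : ∀ {a b c d} → a ≈[ m ] b → c ≈[ m ] d → a - c ≈[ m ] b - d
  ≈-- p q = ≈-+ p (≈-neg q)

≈-∣ : ∀ {m n a b} → + m ∣ + n → a ≈[ n ] b → a ≈[ m ] b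
≈-∣ m∣n (congruent p) = congruent (ℤ∣.∣-trans m∣n p)

record Unit (m : ℕ) (a : ℤ) : Set where
  constructor unit
  field
    inverse : ℤ
    inverseʳ : a * inverse ≈[ m ] 1ℤ

record UnitSquare (m : ℕ) (d : ℤ) : Set where
  constructor unitSquare
  field
    root : ℤ
    root-unit : Unit m root
    root-square : d ≈[ m ] root * root

-- For m ≥ 2 a unit is not 0, so distinct indices automatically carry distinct vertices modulo m.
Clique : ℕ → ℕ → Set
Clique r m = ∃ λ (x : Fin r → ℤ) → ∀ {i j} → i ≢ j → UnitSquare m (x i - x j)

unit-* : ∀ {m a b} → Unit m a → Unit m b → Unit m (a * b)
unit-* {a = a} {b} (unit a′ p) (unit b′ q) =
  unit (a′ * b′) (≈-trans (≈-reflexive (identity a b a′ b′)) (≈-* p q))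
  where
  identity : ∀ a b a′ b′ → a * b * (a′ * b′) ≡ (a * a′) * (b * b′)
  identity = solve-∀

unitSquare-* : ∀ {m a b} → UnitSquare m a → UnitSquare m b → UnitSquare m (a * b)
unitSquare-* (unitSquare s us p) (unitSquare t ut q) =
  unitSquare (s * t) (unit-* us ut) (≈-trans (≈-* p q) (≈-reflexive (identity s t)))
  where
  identity : ∀ s t → s * s * (t * t) ≡ s * t * (s * t)
  identity = solve-∀

unitSquare-resp : ∀ {m a b} → a ≈[ m ] b → UnitSquare m a → UnitSquare m b
unitSquare-resp p (unitSquare s us q) = unitSquare s us (≈-trans (≈-sym p) q)

unitSquare-∣ : ∀ {m n d} → + m ∣ + n → UnitSquare n d → UnitSquare m d
unitSquare-∣ m∣n (unitSquare a (unit b p) q) = unitSquare a (unit b (≈-∣ m∣n p)) (≈-∣ m∣n q)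

clique-∣ : ∀ {r m n} → + m ∣ + n → Clique r n → Clique r m
clique-∣ m∣n (x , adj) = x , λ i≢j → unitSquare-∣ m∣n (adj i≢j)

-- All integers are congruent modulo 1, so even 0 is a unit there. This is the empty product that
-- starts the induction over prime powers.
clique-1 : ∀ r → Clique r 1
clique-1 r = (λ _ → 0ℤ) , λ _ → unitSquare 0ℤ (unit 0ℤ (congruent (divides -1ℤ refl))) ≈-refl

-- Newton's iteration doubles the precision of an inverse and of a square root.

unit-lift : ∀ {m a} → Unit m a → Unit (m ℕ.* m) a
unit-lift {m} {a} (unit b (congruent (divides q eq))) =
  -- With e = ab - 1 the new product is (1 + e)(1 - e), so the error becomes -e².
  unit (b * (1ℤ - (a * b - 1ℤ))) (congruent (divides (- (q * q)) (begin
  a * (b * (1ℤ - (a * b - 1ℤ))) - 1ℤ ≡⟨ identity a b ⟩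
  - ((a * b - 1ℤ) * (a * b - 1ℤ))    ≡⟨ cong (λ e → - (e * e)) eq ⟩
  - ((q * + m) * (q * + m))          ≡⟨ regroup q (+ m) ⟩
  - (q * q) * (+ m * + m)            ≡⟨ cong (- (q * q) *_) (ℤ.pos-* m m) ⟨
  - (q * q) * + (m ℕ.* m)            ∎)))
  where
  open ≡-Reasoning
  identity : ∀ a b → a * (b * (1ℤ - (a * b - 1ℤ))) - 1ℤ ≡ - ((a * b - 1ℤ) * (a * b - 1ℤ))
  identity = solve-∀
  regroup : ∀ q m → - ((q * m) * (q * m)) ≡ - (q * q) * (m * m)
  regroup = solve-∀

unitSquare-lift : ∀ {m d} → Unit m (+ 2) → UnitSquare m d → UnitSquare (m ℕ.* m) d
unitSquare-lift {m} {d} (unit h 2h≈1)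
    (unitSquare a (unit b ab≈1) d≈a²@(congruent (divides q eq))) =
  unitSquare a′ (unit-lift (unit b a′b≈1))
  (congruent (divides (- (q * q′) - (q * c) * (q * c)) (begin
  d - a′ * a′
    ≡⟨ identity d a c ⟩
  - (e * (+ 2 * a * c - 1ℤ)) - (e * c) * (e * c)
    ≡⟨ cong₂ (λ u v → - (u * v) - (u * c) * (u * c)) eq eq′ ⟩
  - (q * + m * (q′ * + m)) - (q * + m * c) * (q * + m * c)
    ≡⟨ regroup q q′ c (+ m) ⟩
  (- (q * q′) - (q * c) * (q * c)) * (+ m * + m)
    ≡⟨ cong ((- (q * q′) - (q * c) * (q * c)) *_) (ℤ.pos-* m m) ⟨
  (- (q * q′) - (q * c) * (q * c)) * + (m ℕ.* m) ∎)))
  where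
  open ≡-Reasoning
  e = d - a * a
  -- `c` inverts 2a modulo m, so `a′` is the Newton step a + (d - a²)/(2a). Its error is -e(2ac - 1)
  -- - (ec)², where both e and 2ac - 1 are multiples of m.
  c = h * b
  a′ = a + e * c
  a′b≈1 : a′ * b ≈[ m ] 1ℤ
  a′b≈1 = ≈-trans
    (≈-* (≈-+ (≈-refl {a = a}) (≈-* (≈-- d≈a² ≈-refl) (≈-refl {a = c}))) (≈-refl {a = b}))
    (≈-trans (≈-reflexive (simplify a c b)) ab≈1)
    where
    simplify : ∀ a c b → (a + (a * a - a * a) * c) * b ≡ a * b
    simplify = solve-∀
  2ac≈1 : + 2 * a * c ≈[ m ] 1ℤ
  2ac≈1 = ≈-trans (≈-reflexive (swap h a b)) (≈-* 2h≈1 ab≈1)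
    where
    swap : ∀ h a b → + 2 * a * (h * b) ≡ (+ 2 * h) * (a * b)
    swap = solve-∀
  q′ = _∣_.quotient (divisible 2ac≈1)
  eq′ = _∣_.equality (divisible 2ac≈1)
  identity : ∀ d a c → d - (a + (d - a * a) * c) * (a + (d - a * a) * c) ≡
    - ((d - a * a) * (+ 2 * a * c - 1ℤ)) - ((d - a * a) * c) * ((d - a * a) * c)
  identity = solve-∀
  regroup : ∀ q r c m → - (q * m * (r * m)) - (q * m * c) * (q * m * c) ≡
    (- (q * r) - (q * c) * (q * c)) * (m * m)
  regroup = solve-∀

-- Lifting from p^(k+1) reaches the square of that modulus; this cuts the result back to the next
-- power, so that the induction moves one exponent at a time.
^-∣-square : ∀ p k → + (p ^ suc (suc k)) ∣ + (p ^ suc k ℕ.* p ^ suc k)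
^-∣-square p k = ℤ∣.∣ᵤ⇒∣ (ℕ.divides (p ^ k) (identity p (p ^ k)))
  where
  identity : ∀ p q → (p ℕ.* q) ℕ.* (p ℕ.* q) ≡ q ℕ.* (p ℕ.* (p ℕ.* q))
  identity = ℕ-Solver.solve-∀

unit-^ : ∀ {p a} k → Unit p a → Unit (p ^ suc k) a
unit-^ {p} {a} zero u = subst (λ m → Unit m a) (sym (ℕ.*-identityʳ p)) u
unit-^ {p} (suc k) u with unit b ab≈1 ← unit-lift (unit-^ k u) =
  unit b (≈-∣ (^-∣-square p k) ab≈1)

-- The vertices never change: the same integers form a clique modulo every power of p, and only the
-- roots of their differences are refined.
clique-^ : ∀ {r p} k → Unit p (+ 2) → Clique r p → Clique r (p ^ suc k)
clique-^ {r} {p} zero u c = subst (Clique r) (sym (ℕ.*-identityʳ p)) c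
clique-^ {p = p} (suc k) u c with x , adj ← clique-^ k u c = x , λ i≢j →
  unitSquare-∣ (^-∣-square p k) (unitSquare-lift (unit-^ k u) (adj i≢j))

-- The Chinese remainder theorem

subtract-bézout : ∀ {m n} x y → 1 ℕ.+ y ℕ.* n ≡ x ℕ.* m → + x * + m + - (+ y) * + n ≡ 1ℤ
subtract-bézout {m} {n} x y eq = begin
  + x * + m + - (+ y) * + n         ≡⟨ cong (_+ - (+ y) * + n) (ℤ.pos-* x m) ⟨
  + (x ℕ.* m) + - (+ y) * + n       ≡⟨ cong (λ t → + t + - (+ y) * + n) eq ⟨
  1ℤ + + (y ℕ.* n) + - (+ y) * + n  ≡⟨ cong (λ t → 1ℤ + t + - (+ y) * + n) (ℤ.pos-* y n) ⟩
  1ℤ + + y * + n + - (+ y) * + n    ≡⟨ cancel (+ y) (+ n) ⟩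
  1ℤ                                ∎
  where
  open ≡-Reasoning
  cancel : ∀ y n → 1ℤ + y * n + - y * n ≡ 1ℤ
  cancel = solve-∀

coprime⇒bézout : ∀ {m n} → Coprime m n → ∃₂ λ u v → u * + m + v * + n ≡ 1ℤ
coprime⇒bézout {m} {n} c with coprime-Bézout c
... | Bézout.+- x y eq = + x , - (+ y) , subtract-bézout x y eq
... | Bézout.-+ x y eq =
  - (+ x) , + y , trans (ℤ.+-comm (- (+ x) * + m) _) (subtract-bézout y x eq)

module _ {m n : ℕ} (m⊥n : Coprime m n) where

  private
    u = proj₁ (coprime⇒bézout m⊥n)
    v = proj₁ (proj₂ (coprime⇒bézout m⊥n))
    um+vn≡1 = proj₂ (proj₂ (coprime⇒bézout m⊥n))

  -- As um + vn = 1, the coefficients um and vn are the two idempotents: um is 0 modulo m and 1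
  -- modulo n, and vn the reverse.
  glue : ℤ → ℤ → ℤ
  glue a b = b * (u * + m) + a * (v * + n)

  glue-≈ˡ : ∀ a b → glue a b ≈[ m ] a
  glue-≈ˡ a b = congruent (divides ((b - a) * u) (begin
    b * (u * + m) + a * (v * + n) - a
      ≡⟨ identity a b u v (+ m) (+ n) ⟩
    (b - a) * u * + m + a * ((u * + m + v * + n) - 1ℤ)
      ≡⟨ cong (λ t → (b - a) * u * + m + a * (t - 1ℤ)) um+vn≡1 ⟩
    (b - a) * u * + m + a * 0ℤ
      ≡⟨ simplify (b - a) u (+ m) a ⟩
    (b - a) * u * + m
      ∎))
    where
    open ≡-Reasoning
    identity : ∀ a b u v m n → b * (u * m) + a * (v * n) - a ≡
      (b - a) * u * m + a * ((u * m + v * n) - 1ℤ)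
    identity = solve-∀
    simplify : ∀ d u m a → d * u * m + a * 0ℤ ≡ d * u * m
    simplify = solve-∀

  glue-≈ʳ : ∀ a b → glue a b ≈[ n ] b
  glue-≈ʳ a b = congruent (divides ((a - b) * v) (begin
    b * (u * + m) + a * (v * + n) - b
      ≡⟨ identity a b u v (+ m) (+ n) ⟩
    (a - b) * v * + n + b * ((u * + m + v * + n) - 1ℤ)
      ≡⟨ cong (λ t → (a - b) * v * + n + b * (t - 1ℤ)) um+vn≡1 ⟩
    (a - b) * v * + n + b * 0ℤ
      ≡⟨ simplify (a - b) v (+ n) b ⟩
    (a - b) * v * + n
      ∎))
    where
    open ≡-Reasoning
    identity : ∀ a b u v m n → b * (u * m) + a * (v * n) - b ≡
      (a - b) * v * n + b * ((u * m + v * n) - 1ℤ)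
    identity = solve-∀
    simplify : ∀ d u m a → d * u * m + a * 0ℤ ≡ d * u * m
    simplify = solve-∀

  ≈-coprime : ∀ {a b} → a ≈[ m ] b → a ≈[ n ] b → a ≈[ m ℕ.* n ] b
  ≈-coprime {a} {b} (congruent (divides q e)) (congruent (divides r f)) =
    congruent (divides (r * u + q * v) (begin
      d                                         ≡⟨ ℤ.*-identityʳ d ⟨
      d * 1ℤ                                    ≡⟨ cong (d *_) um+vn≡1 ⟨
      d * (u * + m + v * + n)                   ≡⟨ ℤ.*-distribˡ-+ d (u * + m) (v * + n) ⟩
      d * (u * + m) + d * (v * + n)             ≡⟨ cong₂ (λ s t → s * _ + t * _) f e ⟩
      r * + n * (u * + m) + q * + m * (v * + n) ≡⟨ regroup q r u v (+ m) (+ n) ⟩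
      (r * u + q * v) * (+ m * + n)             ≡⟨ cong ((r * u + q * v) *_) (ℤ.pos-* m n) ⟨
      (r * u + q * v) * + (m ℕ.* n)             ∎))
    where
    open ≡-Reasoning
    d = a - b
    regroup : ∀ q r u v m n → r * n * (u * m) + q * m * (v * n) ≡ (r * u + q * v) * (m * n)
    regroup = solve-∀

  -- Vertices, roots and inverses of roots are all glued; each required congruence is then checked
  -- modulo m and modulo n separately.
  clique-coprime : ∀ {r} → Clique r m → Clique r n → Clique r (m ℕ.* n)
  clique-coprime (x , adjˣ) (y , adjʸ) = (λ i → glue (x i) (y i)) , adj
    where
    adj : ∀ {i j} → i ≢ j → UnitSquare (m ℕ.* n) (glue (x i) (y i) - glue (x j) (y j))
    adj {i} {j} i≢j
      with unitSquare a (unit a′ p) q ← adjˣ i≢j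
         | unitSquare b (unit b′ r) s ← adjʸ i≢j =
      unitSquare (glue a b)
      (unit (glue a′ b′)
       (≈-coprime (≈-trans (≈-* (glue-≈ˡ a b) (glue-≈ˡ a′ b′)) p)
                 (≈-trans (≈-* (glue-≈ʳ a b) (glue-≈ʳ a′ b′)) r)))
      (≈-coprime
        (≈-trans (≈-- (glue-≈ˡ (x i) (y i)) (glue-≈ˡ (x j) (y j)))
          (≈-trans q (≈-sym (≈-* (glue-≈ˡ a b) (glue-≈ˡ a b)))))
        (≈-trans (≈-- (glue-≈ʳ (x i) (y i)) (glue-≈ʳ (x j) (y j)))
          (≈-trans s (≈-sym (≈-* (glue-≈ʳ a b) (glue-≈ʳ a b))))))

coprime-* : ∀ {m n o} → Coprime m n → Coprime m o → Coprime m (n ℕ.* o)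
coprime-* m⊥n m⊥o (d∣m , d∣no) =
  m⊥o (d∣m , Coprime.coprime-divisor (λ (e∣d , e∣n) → m⊥n (ℕ.∣-trans e∣d d∣m , e∣n)) d∣no)

coprime-product : ∀ {m} k {f : Fin k → ℕ} → (∀ i → Coprime m (f i)) →
  Coprime m (product (tabulate f))
coprime-product zero    _ = Coprime.sym (Coprime.1-coprimeTo _)
coprime-product (suc k) c = coprime-* (c zero) (coprime-product k (c ∘ suc))

coprime-^ : ∀ {m n} k → Coprime m n → Coprime m (n ^ k)
coprime-^ zero    _ = Coprime.sym (Coprime.1-coprimeTo _)
coprime-^ (suc k) c = coprime-* c (coprime-^ k c)

primes-coprime : ∀ {p q} → Prime p → Prime q → p ≢ q → Coprime p q
primes-coprime pp qp p≢q (d∣p , d∣q) with prime⇒irreducible pp d∣p | prime⇒irreducible qp d∣q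
... | inj₁ d≡1  | _         = d≡1
... | inj₂ _    | inj₁ d≡1  = d≡1
... | inj₂ refl | inj₂ refl = contradiction refl p≢q

clique-product : ∀ {r} k {f : Fin k → ℕ} → (∀ {i j} → i ≢ j → Coprime (f i) (f j)) →
  (∀ i → Clique r (f i)) → Clique r (product (tabulate f))
clique-product zero    _  _  = clique-1 _
clique-product (suc k) co cl =
  clique-coprime (coprime-product k λ i → co λ ()) (cl zero)
    (clique-product k (λ i≢j → co (i≢j ∘ suc-injective)) (cl ∘ suc))

∣product : ∀ {k} {f : Fin k → ℕ} i → f i ℕ.∣ product (tabulate f)
∣product {f = f} zero    = ℕ.m∣m*n (product (tabulate (f ∘ suc)))
∣product {f = f} (suc i) = ℕ.∣n⇒∣m*n (f zero) (∣product i)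

-- Counting cliques

∈-subsets : ∀ {n} (S : Subset n) → S ∈ˡ subsets n
∈-subsets []                  = here refl
∈-subsets (true ∷ S)          = ∈-++⁺ˡ (∈-map⁺ (true ∷_) (∈-subsets S))
∈-subsets {suc n} (false ∷ S) =
  ∈-++⁺ʳ (map (true ∷_) (subsets n)) (∈-map⁺ (false ∷_) (∈-subsets S))

member : ∀ {n} (S : Subset n) → Fin ∣ S ∣ → Fin n
member (inside  ∷ S) zero    = zero
member (inside  ∷ S) (suc i) = suc (member S i)
member (outside ∷ S) i       = suc (member S i)

member-∈ : ∀ {n} (S : Subset n) i → member S i ∈ S
member-∈ (inside  ∷ S) zero    = here
member-∈ (inside  ∷ S) (suc i) = there (member-∈ S i)
member-∈ (outside ∷ S) i       = there (member-∈ S i)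

member-injective : ∀ {n} (S : Subset n) → Injective _≡_ _≡_ (member S)
member-injective (inside  ∷ S) {zero}  {zero}  _  = refl
member-injective (inside  ∷ S) {suc i} {suc j} eq = cong suc (member-injective S (suc-injective eq))
member-injective (outside ∷ S) eq = member-injective S (suc-injective eq)

∈-insert⁻ : ∀ {n} {S : Subset n} x {y} → y ∈ S [ x ]≔ inside → y ≡ x ⊎ y ∈ S
∈-insert⁻ {S = _ ∷ _} zero    here      = inj₁ refl
∈-insert⁻ {S = _ ∷ _} zero    (there q) = inj₂ (there q)
∈-insert⁻ {S = _ ∷ _} (suc x) here      = inj₂ here
∈-insert⁻ {S = _ ∷ _} (suc x) (there q) with ∈-insert⁻ x q
... | inj₁ refl = inj₁ refl
... | inj₂ y∈S  = inj₂ (there y∈S)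

∣insert∣ : ∀ {n} {S : Subset n} x → x ∉ S → ∣ S [ x ]≔ inside ∣ ≡ suc ∣ S ∣
∣insert∣ {S = inside  ∷ S} zero    x∉S = contradiction here x∉S
∣insert∣ {S = outside ∷ S} zero    x∉S = refl
∣insert∣ {S = inside  ∷ S} (suc x) x∉S = cong suc (∣insert∣ x (x∉S ∘ there))
∣insert∣ {S = outside ∷ S} (suc x) x∉S = ∣insert∣ x (x∉S ∘ there)

image : ∀ {r n} → (Fin r → Fin n) → Subset n
image {zero}  x = ⊥
image {suc r} x = image (x ∘ suc) [ x zero ]≔ inside

∈-image⁻ : ∀ {r n} (x : Fin r → Fin n) {y} → y ∈ image x → ∃ λ i → y ≡ x i
∈-image⁻ {zero}  x y∈ = contradiction y∈ ∉⊥
∈-image⁻ {suc r} x y∈ with ∈-insert⁻ (x zero) y∈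
... | inj₁ y≡ = zero , y≡
... | inj₂ y∈′ with i , y≡ ← ∈-image⁻ (x ∘ suc) y∈′ = suc i , y≡

∣image∣ : ∀ {r n} (x : Fin r → Fin n) → Injective _≡_ _≡_ x → ∣ image x ∣ ≡ r
∣image∣ {zero}  {n} x inj = ∣⊥∣≡0 n
∣image∣ {suc r} x inj =
  trans (∣insert∣ (x zero) x₀∉) (cong suc (∣image∣ (x ∘ suc) (suc-injective ∘ inj)))
  where
  x₀∉ : x zero ∉ image (x ∘ suc)
  x₀∉ q with i , eq ← ∈-image⁻ (x ∘ suc) q = contradiction (inj eq) λ ()

-- Injectivity is demanded here because `_~_` is arbitrary: for a reflexive relation a constant
-- tuple would otherwise pass as a clique.
EmbeddedClique : ∀ {n} → Rel (Fin n) 0ℓ → ℕ → Set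
EmbeddedClique {n} _~_ r =
  ∃ λ (x : Fin r → Fin n) → Injective _≡_ _≡_ x × (∀ {i j} → i ≢ j → x i ~ x j)

module _ {n} {_~_ : Rel (Fin n) 0ℓ} where

  𝒦≡0⇔¬clique : ∀ r (_~?_ : Decidable _~_) → 𝒦 r _~?_ ≡ 0 ⇔ (¬ EmbeddedClique _~_ r)
  𝒦≡0⇔¬clique r _~?_ = mk⇔ to from
    where
    P? = λ (S : Subset n) → (∣ S ∣ ℕ.≟ r) ×-dec isClique? _~_ _~?_ S

    to : 𝒦 r _~?_ ≡ 0 → ¬ EmbeddedClique _~_ r
    to 𝒦≡0 (x , inj , adj) = contradiction (sym 𝒦≡0)
      (ℕ.<⇒≢ (∈-length (∈-filter⁺ P? (∈-subsets (image x)) (∣image∣ x inj , clique))))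
      where
      clique : IsClique _~_ (image x)
      clique y z y∈ z∈ y≢z with i , refl ← ∈-image⁻ x y∈ | j , refl ← ∈-image⁻ x z∈ =
        adj λ i≡j → y≢z (cong x i≡j)

    from : ¬ EmbeddedClique _~_ r → 𝒦 r _~?_ ≡ 0
    from ¬c = cong length (filter-none P? (All.universal (λ
      { S (refl , cl) → ¬c (member S , member-injective S , λ i≢j →
          cl _ _ (member-∈ S _) (member-∈ S _) (i≢j ∘ member-injective S)) })
      (subsets n)))

-- Residues and their integer representatives

residue : ∀ {n} .{{_ : NonZero n}} → ℤ → Fin n
residue {n} z = fromℕ< (n%ℕd<d z n)

⟦residue⟧ : ∀ {n} .{{_ : NonZero n}} z → ⟦ residue {n} z ⟧ ≈[ n ] z
⟦residue⟧ {n} z = ≈-sym (congruent (divides (z /ℕ n) (begin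
  z - ⟦ residue {n} z ⟧                   ≡⟨ cong (λ t → z - + t) (toℕ-fromℕ< (n%ℕd<d z n)) ⟩
  z - + (z %ℕ n)                          ≡⟨ cong (_- + (z %ℕ n)) (a≡a%ℕn+[a/ℕn]*n z n) ⟩
  + (z %ℕ n) + z /ℕ n * + n - + (z %ℕ n)  ≡⟨ cancel (+ (z %ℕ n)) (z /ℕ n * + n) ⟩
  z /ℕ n * + n                            ∎)))
  where
  open ≡-Reasoning
  cancel : ∀ r s → r + s - r ≡ s
  cancel = solve-∀

∣∧<⇒≡0 : ∀ {n d} → n ℕ.∣ d → d ℕ.< n → d ≡ 0
∣∧<⇒≡0 {d = zero}  _   _   = refl
∣∧<⇒≡0 {d = suc _} n∣d d<n = contradiction n∣d (ℕ.>⇒∤ d<n)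

≈⇒∣∸ : ∀ {n a b} → a ℕ.≤ b → + a ≈[ n ] + b → n ℕ.∣ b ℕ.∸ a
≈⇒∣∸ {n} {a} {b} a≤b (congruent p) = subst (n ℕ.∣_) ∣a-b∣≡b∸a (ℤ∣.∣⇒∣ᵤ p)
  where
  ∣a-b∣≡b∸a : ℤ.∣ + a - + b ∣ ≡ b ℕ.∸ a
  ∣a-b∣≡b∸a = trans (cong ℤ.∣_∣ (ℤ.m-n≡m⊖n a b)) (ℤ.∣⊖∣-≤ a≤b)

≈∧<⇒≥ : ∀ {n a b} → a ℕ.≤ b → b ℕ.< n → + a ≈[ n ] + b → b ℕ.≤ a
≈∧<⇒≥ {n} {a} {b} a≤b b<n p =
  ℕ.m∸n≡0⇒m≤n (∣∧<⇒≡0 (≈⇒∣∸ a≤b p) (ℕ.≤-<-trans (ℕ.m∸n≤m b a) b<n))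

≈∧<⇒≡ : ∀ {n a b} → a ℕ.< n → b ℕ.< n → + a ≈[ n ] + b → a ≡ b
≈∧<⇒≡ {n} {a} {b} a<n b<n p with ℕ.≤-total a b
... | inj₁ a≤b = ℕ.≤-antisym a≤b (≈∧<⇒≥ a≤b b<n p)
... | inj₂ b≤a = ℕ.≤-antisym (≈∧<⇒≥ b≤a a<n (≈-sym p)) b≤a

unitSquare⇒unit : ∀ {m d} → UnitSquare m d → Unit m d
unitSquare⇒unit (unitSquare a u p) with unit b q ← unit-* u u =
  unit b (≈-trans (≈-* p ≈-refl) q)

unit-0⇒≡1 : ∀ {m d} → Unit m d → d ≈[ m ] 0ℤ → m ≡ 1
unit-0⇒≡1 {m} {d} (unit b p) d≈0 =
  ℕ.∣1⇒≡1 (ℤ∣.∣⇒∣ᵤ (divisible (≈-trans (≈-sym p) (≈-* d≈0 (≈-refl {a = b})))))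

unitSquare⇒Paley : ∀ {n} .{{_ : NonZero n}} (x y : Fin n) →
  UnitSquare n (⟦ x ⟧ - ⟦ y ⟧) → Paley n x y
unitSquare⇒Paley x y (unitSquare a (unit b p) q) =
  residue a ,
  (residue b , divisible (≈-trans (≈-* (⟦residue⟧ a) (⟦residue⟧ b)) p)) ,
  divisible (≈-trans q (≈-sym (≈-* (⟦residue⟧ a) (⟦residue⟧ a))))

Paley⇒unitSquare : ∀ {n} (x y : Fin n) → Paley n x y → UnitSquare n (⟦ x ⟧ - ⟦ y ⟧)
Paley⇒unitSquare x y (a , (b , p) , q) =
  unitSquare ⟦ a ⟧ (unit ⟦ b ⟧ (congruent p)) (congruent q)

embeddedClique⇔clique : ∀ {r n} → 2 ℕ.≤ n → EmbeddedClique (Paley n) r ⇔ Clique r n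
embeddedClique⇔clique {r} {n} (s≤s (s≤s _)) = mk⇔
  (λ (x , _ , adj) → ⟦_⟧ ∘ x , λ {i} {j} i≢j → Paley⇒unitSquare (x i) (x j) (adj i≢j))
  embed
  where
  embed : Clique r n → EmbeddedClique (Paley n) r
  embed (x , adj) = residue ∘ x , inj , λ i≢j →
      unitSquare⇒Paley (residue (x _)) (residue (x _)) (adj′ i≢j)
    where
    adj′ : ∀ {i j} → i ≢ j → UnitSquare n (⟦ residue {n} (x i) ⟧ - ⟦ residue {n} (x j) ⟧)
    adj′ {i} {j} i≢j =
      unitSquare-resp (≈-sym (≈-- (⟦residue⟧ (x i)) (⟦residue⟧ (x j)))) (adj i≢j)
    inj : Injective _≡_ _≡_ (residue ∘ x)
    inj {i} {j} eq with i ≟ᶠ j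
    ... | yes i≡j = i≡j
    -- Equal residues would make a unit difference congruent to 0, which happens only modulo 1.
    ... | no  i≢j = contradiction
      (unit-0⇒≡1 (unitSquare⇒unit (adj′ i≢j))
        (≈-reflexive (ℤ.i≡j⇒i-j≡0 (cong ⟦_⟧ eq)))) λ ()

-- The primes 5, 13 and 17

-- By translation, one vertex of a clique may be taken to be 0.
K₄-free : ℕ → Set
K₄-free n =
  ∀ y → y ~ zero → ∀ z → z ~ zero → z ~ y → ∀ w → w ~ zero → w ~ y → ¬ w ~ z
  where _~_ = Paley (suc n)

-- Each edge is tested as soon as both its ends are chosen, so the search abandons a partial choice
-- at its first non-edge.
K₄-free? : ∀ n → Dec (K₄-free n)
K₄-free? n = all? λ y → y ~? zero →-dec all? λ z → z ~? zero →-dec (z ~? y →-dec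
  all? λ w → w ~? zero →-dec (w ~? y →-dec ¬? (w ~? z)))
  where _~?_ = G (suc n)

K₄-free-5 : K₄-free 4
K₄-free-5 = from-yes (K₄-free? 4)

K₄-free-13 : K₄-free 12
K₄-free-13 = from-yes (K₄-free? 12)

K₄-free-17 : K₄-free 16
K₄-free-17 = from-yes (K₄-free? 16)

K₄-free⇒¬clique : ∀ {n} → K₄-free n → ¬ Clique 4 (suc n)
K₄-free⇒¬clique {n} free (x , adj) =
  free (v 1F) (edge₀ λ ()) (v 2F) (edge₀ λ ()) (edge λ ())
    (v 3F) (edge₀ λ ()) (edge λ ()) (edge λ ())
  where
  v : Fin 4 → Fin (suc n)
  v i = residue (x i - x 0F)
  edge : ∀ {i j} → i ≢ j → Paley (suc n) (v i) (v j)
  edge {i} {j} i≢j = unitSquare⇒Paley (v i) (v j) (unitSquare-resp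
    (≈-trans (≈-reflexive (translate (x i) (x j) (x 0F)))
      (≈-sym (≈-- (⟦residue⟧ (x i - x 0F)) (⟦residue⟧ (x j - x 0F)))))
    (adj i≢j))
    where
    translate : ∀ a b c → a - b ≡ (a - c) - (b - c)
    translate = solve-∀
  edge₀ : ∀ {i} → i ≢ 0F → Paley (suc n) (v i) 0F
  edge₀ {i} i≢0 = unitSquare⇒Paley (v i) 0F (unitSquare-resp
    (≈-trans (≈-reflexive (sym (ℤ.+-identityʳ (x i - x 0F))))
      (≈-sym (≈-- (⟦residue⟧ (x i - x 0F)) (≈-refl {a = 0ℤ}))))
    (adj i≢0))

-- Ramsey's theorem

module _ {A : Set} where

  allPairs-⊆ : ∀ {R : Rel A 0ℓ} {xs ys} → xs ⊆ ys → AllPairs R ys → AllPairs R xs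
  allPairs-⊆ []             []         = []
  allPairs-⊆ (y ∷ʳ p)       (_  ∷ rys) = allPairs-⊆ p rys
  allPairs-⊆ (refl ∷ p)     (ry ∷ rys) = All-resp-⊆ p ry ∷ allPairs-⊆ p rys

  allPairs-lookup : ∀ {R : Rel A 0ℓ} → Symmetric R → ∀ {xs} → AllPairs R xs →
    ∀ {i j} → i ≢ j → R (lookup xs i) (lookup xs j)
  allPairs-lookup R-sym (_  ∷ _)  {zero}  {zero}  i≢j = contradiction refl i≢j
  allPairs-lookup R-sym (rx ∷ _)  {zero}  {suc j} _   = All.lookup rx (∈-lookup j)
  allPairs-lookup R-sym (rx ∷ _)  {suc i} {zero}  _   = R-sym (All.lookup rx (∈-lookup i))
  allPairs-lookup R-sym (_ ∷ rxs) {suc i} {suc j} i≢j =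
    allPairs-lookup R-sym rxs λ i≡j → i≢j (cong suc i≡j)

  split : ∀ {P Q : Pred A 0ℓ} {xs} → All (P ∪ Q) xs → ∃₂ λ ys zs →
    length ys ℕ.+ length zs ≡ length xs × (ys ⊆ xs × All P ys) × (zs ⊆ xs × All Q zs)
  split [] = [] , [] , refl , ([] , []) , ([] , [])
  split {xs = x ∷ _} (inj₁ px ∷ pqs)
    with ys , zs , eq , (ys⊆ , pys) , (zs⊆ , qzs) ← split pqs =
    x ∷ ys , zs , cong suc eq , (refl ∷ ys⊆ , px ∷ pys) , (x ∷ʳ zs⊆ , qzs)
  split {xs = x ∷ _} (inj₂ qx ∷ pqs)
    with ys , zs , eq , (ys⊆ , pys) , (zs⊆ , qzs) ← split pqs =
    ys , x ∷ zs , trans (ℕ.+-suc (length ys) (length zs)) (cong suc eq) ,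
    (x ∷ʳ ys⊆ , pys) , (refl ∷ zs⊆ , qx ∷ qzs)

  -- A sublist keeps the order, so a pair is only ever related from its earlier to its later
  -- element. The other direction is recovered when a clique is built from the list.
  Homogeneous : ℕ → Rel A 0ℓ → Pred (List A) 0ℓ
  Homogeneous n R xs = ∃ λ ys → ys ⊆ xs × length ys ≡ n × AllPairs R ys

  homogeneous-⊆ : ∀ {n R xs ys} → xs ⊆ ys → Homogeneous n R xs → Homogeneous n R ys
  homogeneous-⊆ xs⊆ys (zs , zs⊆xs , h) = zs , ⊆-trans zs⊆xs xs⊆ys , h

  homogeneous-∷ : ∀ {n R x xs ys} → ys ⊆ xs → All (R x) ys → Homogeneous n R ys →
    Homogeneous (suc n) R (x ∷ xs)
  homogeneous-∷ {x = x} ys⊆xs rx (zs , zs⊆ys , eq , rzs) =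
    x ∷ zs , refl ∷ ⊆-trans zs⊆ys ys⊆xs , cong suc eq , All-resp-⊆ zs⊆ys rx ∷ rzs

  homogeneous-1 : ∀ {R : Rel A 0ℓ} {xs} → 1 ℕ.≤ length xs → Homogeneous 1 R xs
  homogeneous-1 {xs = x ∷ xs} _ = x ∷ [] , refl ∷ minimum xs , refl , [] ∷ []

-- The Erdős–Szekeres bound for the Ramsey number R(s + 1, t + 1).
ramseyBound : ℕ → ℕ → ℕ
ramseyBound zero    t       = 1
ramseyBound (suc s) zero    = 1
ramseyBound (suc s) (suc t) = ramseyBound s (suc t) ℕ.+ ramseyBound (suc s) t

ramseyBound>0 : ∀ s t → 1 ℕ.≤ ramseyBound s t
ramseyBound>0 zero    t       = ℕ.≤-refl
ramseyBound>0 (suc s) zero    = ℕ.≤-refl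
ramseyBound>0 (suc s) (suc t) = ℕ.≤-trans (ramseyBound>0 s (suc t)) (ℕ.m≤m+n _ _)

-- The extra 1 on the right is the vertex split off in Ramsey's induction; a and b count its
-- neighbours in the two colours.
+-pigeonhole : ∀ {m n} a b → m ℕ.+ n ℕ.≤ suc (a ℕ.+ b) → m ℕ.≤ a ⊎ n ℕ.≤ b
+-pigeonhole {m} {n} a b m+n≤ with m ℕ.≤? a
... | yes m≤a = inj₁ m≤a
... | no  m≰a =
  inj₂ (ℕ.+-cancelˡ-≤ (suc a) n b (ℕ.≤-trans (ℕ.+-monoˡ-≤ n (ℕ.≰⇒> m≰a)) m+n≤))

-- The vertices after `x` are split by the colour of their edge to `x`. One class is large enough
-- for the induction, and `x` extends a homogeneous set of that class's own colour.
ramsey : ∀ {A : Set} {R B : Rel A 0ℓ} s t {xs} → ramseyBound s t ℕ.≤ length xs →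
  AllPairs (λ x y → R x y ⊎ B x y) xs → Homogeneous (suc s) R xs ⊎ Homogeneous (suc t) B xs
ramsey zero    t       ≤xs _ = inj₁ (homogeneous-1 ≤xs)
ramsey (suc s) zero    ≤xs _ = inj₂ (homogeneous-1 ≤xs)
ramsey (suc s) (suc t) {[]} ≤xs [] = contradiction ≤xs (ℕ.<⇒≱ (ramseyBound>0 (suc s) (suc t)))
ramsey (suc s) (suc t) {x ∷ xs} ≤xs (cx ∷ cxs)
  with ys , zs , eq , (ys⊆ , rys) , (zs⊆ , bzs) ← split cx
  with +-pigeonhole (length ys) (length zs) (subst (λ l → _ ℕ.≤ suc l) (sym eq) ≤xs)
... | inj₁ ≤ys with ramsey s (suc t) ≤ys (allPairs-⊆ ys⊆ cxs)
...   | inj₁ h = inj₁ (homogeneous-∷ ys⊆ rys h)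
...   | inj₂ h = inj₂ (homogeneous-⊆ (x ∷ʳ ys⊆) h)
ramsey (suc s) (suc t) {x ∷ xs} ≤xs (cx ∷ cxs)
    | inj₂ ≤zs with ramsey (suc s) t ≤zs (allPairs-⊆ zs⊆ cxs)
...   | inj₁ h = inj₁ (homogeneous-⊆ (x ∷ʳ zs⊆) h)
...   | inj₂ h = inj₂ (homogeneous-∷ zs⊆ bzs h)

-- Squares modulo a prime

-- The involution pairs the elements off: `x` and `f x` are removed together. What remains is not a
-- tail of the list, hence the recursion on the length `n`.
even-length : ∀ {A : Set} (f : A → A) → (∀ x → f (f x) ≡ x) →
  ∀ n xs → length xs ≡ n → Unique xs →
  (∀ {x} → x ∈ˡ xs → f x ∈ˡ xs) → (∀ {x} → x ∈ˡ xs → f x ≢ x) → 2 ℕ.∣ n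
even-length f invol zero          _  _ _ _      _     = 2 ℕ.∣0
even-length f invol (suc zero)    (x ∷ []) _ _ closed moves with closed (here refl)
... | here fx≡x = contradiction fx≡x (moves (here refl))
even-length {A} f invol (suc (suc n)) (x ∷ xs) len (x∉ ∷ uniq) closed moves
  with closed (here refl)
... | here fx≡x   = contradiction fx≡x (moves (here refl))
... | there fx∈xs with as , bs , refl ← ∈-∃++ fx∈xs =
  ℕ.∣m∣n⇒∣m+n ℕ.∣-refl (even-length f invol n zs len′ uniq-zs closed′ (moves ∘ there ∘ ↭-there))
  where
  zs = as ++ bs
  π : as ++ f x ∷ bs ↭ f x ∷ zs
  π = shift (f x) as bs
  ↭-there : ∀ {z} → z ∈ˡ zs → z ∈ˡ as ++ f x ∷ bs
  ↭-there z∈ = ∈-resp-↭ (↭-sym π) (there z∈)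
  uniq′ : Unique (f x ∷ zs)
  uniq′ = Unique-resp-↭ (setoid A) (↭⇒↭ₛ π) uniq
  uniq-zs : Unique zs
  uniq-zs = AllPairs.tail uniq′
  len′ : length zs ≡ n
  len′ = ℕ.suc-injective (trans (sym (↭-length π)) (ℕ.suc-injective len))
  closed′ : ∀ {z} → z ∈ˡ zs → f z ∈ˡ zs
  -- Were `f z` equal to `x` or `f x`, then `z` would be `f x` or `x`, both of which have been
  -- removed.
  closed′ {z} z∈ with closed (there (↭-there z∈))
  ... | here fz≡x =
    contradiction (trans (cong f (sym fz≡x)) (invol z)) (All.lookup (AllPairs.head uniq′) z∈)
  ... | there fz∈ with ∈-resp-↭ π fz∈
  ...   | there fz∈zs = fz∈zs
  ...   | here fz≡fx =
    contradiction (trans (sym (invol x)) (trans (cong f (sym fz≡fx)) (invol z)))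
      (All.lookup x∉ (↭-there z∈))

_≈?_ : ∀ {m} a b → Dec (a ≈[ m ] b)
_≈?_ {m} a b = map′ congruent divisible (+ m ∣? (a - b))

-- This decision procedure and the inverses below are abstract because their
-- normal forms are too large to be computed in with-abstractions.
abstract
  unitSquare? : ∀ {m} .{{_ : NonZero m}} d → Dec (UnitSquare m d)
  unitSquare? {suc m} d = map′
    (λ e → unitSquare-resp d′≈d (Paley⇒unitSquare (residue d) 0F e))
    (λ u → unitSquare⇒Paley (residue d) 0F (unitSquare-resp (≈-sym d′≈d) u))
    (G (suc m) (residue d) 0F)
    where
    d′≈d : ⟦ residue {suc m} d ⟧ - 0ℤ ≈[ suc m ] d
    d′≈d = ≈-trans (≈-reflexive (ℤ.+-identityʳ ⟦ residue {suc m} d ⟧)) (⟦residue⟧ d)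

unit-1 : ∀ {m} → Unit m 1ℤ
unit-1 = unit 1ℤ ≈-refl

unit-resp : ∀ {m a b} → a ≈[ m ] b → Unit m a → Unit m b
unit-resp a≈b (unit c ac≈1) = unit c (≈-trans (≈-* (≈-sym a≈b) ≈-refl) ac≈1)

≈-cancelˡ : ∀ {m a b c} → Unit m a → a * b ≈[ m ] a * c → b ≈[ m ] c
≈-cancelˡ {a = a} {b} {c} (unit t at≈1) p =
  ≈-trans (≈-sym (absorb b)) (≈-trans (≈-* (≈-refl {a = t}) p) (absorb c))
  where
  regroup : ∀ t a x → t * (a * x) ≡ (a * t) * x
  regroup = solve-∀
  absorb : ∀ x → t * (a * x) ≈[ _ ] x
  absorb x = ≈-trans (≈-reflexive (regroup t a x))
    (≈-trans (≈-* at≈1 (≈-refl {a = x})) (≈-reflexive (ℤ.*-identityˡ x)))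

-- c d = (d b / a)²
unitSquare-quotient : ∀ {m c d a b} → Unit m c → Unit m d → Unit m a → Unit m b →
  c * (a * a) ≈[ m ] d * (b * b) → UnitSquare m (c * d)
unitSquare-quotient {m} {c} {d} {a} {b} uc ud (unit t at≈1) ub p =
  unitSquare (d * b * t) (unit-* (unit-* ud ub) ut) (≈-sym
    (≈-trans (≈-reflexive (expand d b t))
    (≈-trans (≈-* (≈-refl {a = d}) (≈-* (≈-sym p) (≈-refl {a = t * t})))
    (≈-trans (≈-reflexive (regroup c d a t))
    (≈-trans (≈-* (≈-refl {a = c * d}) (≈-* at≈1 at≈1))
      (≈-reflexive (ℤ.*-identityʳ (c * d))))))))
  where
  ut : Unit m t
  ut = unit a (≈-trans (≈-reflexive (ℤ.*-comm t a)) at≈1)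
  expand : ∀ d b t → d * b * t * (d * b * t) ≡ d * (d * (b * b) * (t * t))
  expand = solve-∀
  regroup : ∀ c d a t → d * (c * (a * a) * (t * t)) ≡ c * d * ((a * t) * (a * t))
  regroup = solve-∀

≈-difference : ∀ {m a b} → a - b ≈[ m ] 0ℤ → a ≈[ m ] b
≈-difference {m} {a} {b} p = congruent (subst (+ m ∣_) (ℤ.+-identityʳ (a - b)) (divisible p))

module _ {p : ℕ} (pp : Prime p) where

  private instance
    _ = prime⇒nonZero pp

  0<r<p⇒unit : ∀ r .{{_ : NonZero r}} → r ℕ.< p → Unit p (+ r)
  0<r<p⇒unit r r<p with u , v , up+vr≡1 ← coprime⇒bézout (prime⇒coprime pp r<p) =
    unit v (congruent (divides (- u) (begin
      + r * v - 1ℤ                    ≡⟨ cong (λ t → + r * v - t) up+vr≡1 ⟨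
      + r * v - (u * + p + v * + r)   ≡⟨ identity (+ r) u v (+ p) ⟩
      - u * + p                       ∎)))
    where
    open ≡-Reasoning
    identity : ∀ r u v p → r * v - (u * p + v * r) ≡ - u * p
    identity = solve-∀

  abstract
    ≉0⇒unit : ∀ {a} → ¬ a ≈[ p ] 0ℤ → Unit p a
    ≉0⇒unit {a} a≉0 =
      unit-resp (⟦residue⟧ a) (0<r<p⇒unit (toℕ r) {{ℕ.≢-nonZero r≢0}} (toℕ<n r))
      where
      r : Fin p
      r = residue a
      r≢0 : toℕ r ≢ 0
      r≢0 r≡0 = a≉0 (≈-trans (≈-sym (⟦residue⟧ a)) (≈-reflexive (cong +_ r≡0)))

  zero-product : ∀ {a b} → a * b ≈[ p ] 0ℤ → a ≈[ p ] 0ℤ ⊎ b ≈[ p ] 0ℤ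
  zero-product {a} {b} ab≈0 with a ≈? 0ℤ
  ... | yes a≈0 = inj₁ a≈0
  ... | no  a≉0 =
    inj₂ (≈-cancelˡ (≉0⇒unit a≉0) (≈-trans ab≈0 (≈-reflexive (sym (ℤ.*-zeroʳ a)))))

  unit⇒≉0 : ∀ {a} → Unit p a → ¬ a ≈[ p ] 0ℤ
  unit⇒≉0 u a≈0 = contradiction (subst Prime (unit-0⇒≡1 u a≈0) pp) ¬prime[1]

remQuot-injective : ∀ {m} n → Injective _≡_ _≡_ (remQuot {m} n)
remQuot-injective {m} n {x} {y} e =
  trans (sym (combine-remQuot {m} n x))
    (trans (cong (λ (i , j) → combine i j) e) (combine-remQuot {m} n y))

-- The numbers 1, …, h represent the nonzero residues modulo 2h + 1 up to sign.
module _ {h : ℕ} (pp : Prime (suc (h ℕ.+ h))) where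

  private
    p : ℕ
    p = suc (h ℕ.+ h)

  rep : Fin h → ℤ
  rep i = + suc (toℕ i)

  rep<p : ∀ i → suc (toℕ i) ℕ.< p
  rep<p i = s≤s (ℕ.≤-trans (toℕ<n i) (ℕ.m≤m+n h h))

  rep-unit : ∀ i → Unit p (rep i)
  rep-unit i = ≉0⇒unit pp λ s≈0 → contradiction (≈∧<⇒≡ (rep<p i) (s≤s z≤n) s≈0) λ ()

  -- A difference of squares factors, and the sum of two representatives lies strictly between 0 and
  -- p, so only the other factor can vanish.
  rep²-injective : ∀ {i j} → rep i * rep i ≈[ p ] rep j * rep j → i ≡ j
  rep²-injective {i} {j} e
    with zero-product pp {rep i - rep j} {rep i + rep j}
           (≈-trans (≈-reflexive (factor (rep i) (rep j)))
           (congruent (divides′ e)))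
    where
    factor : ∀ a b → (a - b) * (a + b) ≡ a * a - b * b
    factor = solve-∀
    divides′ : ∀ {a b} → a ≈[ p ] b → + p ∣ (a - b - 0ℤ)
    divides′ {a} {b} e = subst (+ p ∣_) (sym (ℤ.+-identityʳ (a - b))) (divisible e)
  ... | inj₁ d≈0 =
    toℕ-injective (ℕ.suc-injective (≈∧<⇒≡ (rep<p i) (rep<p j) (≈-difference d≈0)))
  ... | inj₂ σ≈0 =
    contradiction (≈∧<⇒≡ (s≤s (ℕ.+-mono-≤ (toℕ<n i) (toℕ<n j))) (s≤s z≤n) σ≈0) λ ()

  rep²-surjective : ∀ {a} → Unit p a → ∃ λ i → rep i * rep i ≈[ p ] a * a
  rep²-surjective {a} u with residue {p} a in eq
  ... | zero =
    contradiction (≈-trans (≈-sym (⟦residue⟧ a)) (≈-reflexive (cong ⟦_⟧ eq))) (unit⇒≉0 pp u)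
  ... | suc r with toℕ r ℕ.<? h
  ...   | yes r<h = fromℕ< r<h , ≈-* r≈a r≈a
    where
    r≈a : rep (fromℕ< r<h) ≈[ p ] a
    r≈a = ≈-trans
      (≈-reflexive (trans (cong (λ t → + suc t) (toℕ-fromℕ< r<h)) (cong ⟦_⟧ (sym eq))))
      (⟦residue⟧ a)
  ...   | no r≮h = fromℕ< t<h , ≈-trans (≈-* t≈-a t≈-a) (≈-reflexive (neg² a))
    where
    -- Since `rep` adds 1, this index stands for p - (r + 1), the negative of the residue of `a`,
    -- which has the same square.
    t = h ℕ.+ h ℕ.∸ suc (toℕ r)
    t+r : t ℕ.+ suc (toℕ r) ≡ h ℕ.+ h
    t+r = ℕ.m∸n+n≡m (toℕ<n r)
    t<h : t ℕ.< h
    t<h = ℕ.+-cancelʳ-< (suc (toℕ r)) t h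
      (subst (ℕ._< h ℕ.+ suc (toℕ r)) (sym t+r) (ℕ.+-monoʳ-< h (s≤s (ℕ.≮⇒≥ r≮h))))
    t≈-a : rep (fromℕ< t<h) ≈[ p ] - a
    t≈-a = ≈-trans (congruent (divides 1ℤ (begin
      rep (fromℕ< t<h) - - + suc (toℕ r)
        ≡⟨ cong₂ _+_ (cong (λ n → + suc n) (toℕ-fromℕ< t<h)) (ℤ.neg-involutive (+ suc (toℕ r))) ⟩
      + (suc t ℕ.+ suc (toℕ r))
        ≡⟨ cong (λ n → + suc n) t+r ⟩
      + p
        ≡⟨ ℤ.*-identityˡ (+ p) ⟨
      1ℤ * + p
        ∎)))
      (≈-neg (≈-trans (≈-reflexive (cong ⟦_⟧ (sym eq))) (⟦residue⟧ a)))
      where open ≡-Reasoning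
    neg² : ∀ a → - a * - a ≡ a * a
    neg² = solve-∀

  -- The 3h elements c k * i², 1 ≤ i ≤ h, cannot be distinct among 2h nonzero residues.
  square-among-three : (c : Fin 3 → ℤ) → (∀ k → Unit p (c k)) →
    ∃₂ λ k l → k ≢ l × UnitSquare p (c k * c l)
  square-among-three c uc = collision (pigeonhole 2h<3h f)
    where
    0<h : 0 ℕ.< h
    0<h = ℕ.n≢0⇒n>0 λ h≡0 → ¬prime[1] (subst (λ h → Prime (suc (h ℕ.+ h))) h≡0 pp)
    2h<3h : h ℕ.+ h ℕ.< 3 ℕ.* h
    2h<3h = ℕ.+-monoʳ-< h (ℕ.m<m+n h (ℕ.≤-trans 0<h (ℕ.m≤m+n h 0)))
    value : Fin 3 × Fin h → ℤ
    value (k , i) = c k * (rep i * rep i)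
    value≉0 : ∀ x → 0F ≢ residue {p} (value x)
    value≉0 (k , i) eq = unit⇒≉0 pp (unit-* (uc k) (unit-* (rep-unit i) (rep-unit i)))
      (≈-trans (≈-sym (⟦residue⟧ (value (k , i)))) (≈-reflexive (cong ⟦_⟧ (sym eq))))
    f : Fin (3 ℕ.* h) → Fin (h ℕ.+ h)
    f x = punchOut (value≉0 (remQuot h x))
    value-≈ : ∀ x y → punchOut (value≉0 x) ≡ punchOut (value≉0 y) → value x ≈[ p ] value y
    value-≈ x y eq = ≈-trans (≈-sym (⟦residue⟧ (value x)))
      (≈-trans (≈-reflexive (cong ⟦_⟧ (punchOut-injective (value≉0 x) (value≉0 y) eq)))
        (⟦residue⟧ (value y)))
    compare : ∀ x y → value x ≈[ p ] value y →
      x ≡ y ⊎ ∃₂ λ k l → k ≢ l × UnitSquare p (c k * c l)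
    -- For equal multipliers the squares agree and the pigeons coincide; otherwise the collision
    -- exhibits c k * c l as a square.
    compare (k , i) (l , j) e with k ≟ᶠ l
    ... | no k≢l   =
      inj₂ (k , l , k≢l , unitSquare-quotient (uc k) (uc l) (rep-unit i) (rep-unit j) e)
    ... | yes refl = inj₁ (cong (k ,_) (rep²-injective (≈-cancelˡ (uc k) e)))
    collision : (∃₂ λ x y → x Fin.< y × f x ≡ f y) →
      ∃₂ λ k l → k ≢ l × UnitSquare p (c k * c l)
    collision (x , y , x<y , eq) =
      [ (λ e → contradiction (remQuot-injective {3} h e) (<⇒≢ x<y)) , id ]′
        (compare (remQuot h x) (remQuot h y) (value-≈ (remQuot h x) (remQuot h y) eq))

  -- The unit squares have index at most two: among 1, a and b some two multiply to a square, and
  -- the pairs containing 1 are excluded.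
  nonsquare-* : ∀ {a b} → Unit p a → Unit p b → ¬ UnitSquare p a → ¬ UnitSquare p b →
    UnitSquare p (a * b)
  nonsquare-* {a} {b} ua ub ¬a ¬b = select (square-among-three c uc)
    where
    c : Fin 3 → ℤ
    c 0F = 1ℤ
    c 1F = a
    c 2F = b
    uc : ∀ k → Unit p (c k)
    uc 0F = unit-1
    uc 1F = ua
    uc 2F = ub
    select : (∃₂ λ k l → k ≢ l × UnitSquare p (c k * c l)) → UnitSquare p (a * b)
    select (0F , 1F , _ , q) = contradiction (subst (UnitSquare p) (ℤ.*-identityˡ a) q) ¬a
    select (0F , 2F , _ , q) = contradiction (subst (UnitSquare p) (ℤ.*-identityˡ b) q) ¬b
    select (1F , 0F , _ , q) = contradiction (subst (UnitSquare p) (ℤ.*-identityʳ a) q) ¬a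
    select (1F , 2F , _ , q) = q
    select (2F , 0F , _ , q) = contradiction (subst (UnitSquare p) (ℤ.*-identityʳ b) q) ¬b
    select (2F , 1F , _ , q) = subst (UnitSquare p) (ℤ.*-comm b a) q
    select (0F , 0F , k≢l , _) = contradiction refl k≢l
    select (1F , 1F , k≢l , _) = contradiction refl k≢l
    select (2F , 2F , k≢l , _) = contradiction refl k≢l

  abstract
    -- Inversion descends to residues up to sign; comparing squares absorbs the sign.
    reciprocal : ∀ i → ∃ λ j → rep i * rep i * (rep j * rep j) ≈[ p ] 1ℤ
    reciprocal i = let
        unit t st≈1 = rep-unit i
        j , sj²≈t² = rep²-surjective {t}
          (unit (rep i) (≈-trans (≈-reflexive (ℤ.*-comm t (rep i))) st≈1))
      in j , ≈-trans (≈-* (≈-refl {a = rep i * rep i}) sj²≈t²)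
        (≈-trans (≈-reflexive (regroup (rep i) t)) (≈-* st≈1 st≈1))
      where
      regroup : ∀ a t → a * a * (t * t) ≡ (a * t) * (a * t)
      regroup = solve-∀

  reciprocal-unique : ∀ {i j k} → rep i * rep i * (rep j * rep j) ≈[ p ] 1ℤ →
    rep i * rep i * (rep k * rep k) ≈[ p ] 1ℤ → j ≡ k
  reciprocal-unique {i} d e =
    rep²-injective (≈-cancelˡ (unit-* (rep-unit i) (rep-unit i)) (≈-trans d (≈-sym e)))

  -- For s = `rep i`, s⁴ - 1 = (s² - 1)(s² + 1), and a zero of the second factor is a square root of
  -- -1.
  self-reciprocal : ∀ {i} → rep i * rep i * (rep i * rep i) ≈[ p ] 1ℤ →
    rep i * rep i ≈[ p ] 1ℤ ⊎ UnitSquare p -1ℤ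
  self-reciprocal {i} e with zero-product pp {rep i * rep i - 1ℤ} {rep i * rep i + 1ℤ}
      (≈-trans (≈-reflexive (factor (rep i * rep i))) (≈-- e (≈-refl {a = 1ℤ})))
    where
    factor : ∀ a → (a - 1ℤ) * (a + 1ℤ) ≡ a * a - 1ℤ
    factor = solve-∀
  ... | inj₁ d = inj₁ (≈-difference d)
  ... | inj₂ d = inj₂ (unitSquare (rep i) (rep-unit i) (≈-sym (≈-difference d)))

-- Were -1 not a square, inversion up to sign would be an involution of
-- {1, …, h} fixing 1 only, so that h would be odd.
unitSquare--1 : ∀ {h} → Prime (suc (h ℕ.+ h)) → 2 ℕ.∣ h → UnitSquare (suc (h ℕ.+ h)) -1ℤ
unitSquare--1 {zero}  pp _   = contradiction pp ¬prime[1]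
unitSquare--1 {suc h} pp 2∣h = decidable-stable (unitSquare? -1ℤ) λ ¬sq →
  contradiction (ℕ.∣m+n∣m⇒∣n (subst (2 ℕ.∣_) (ℕ.+-comm 1 h) 2∣h) (even ¬sq))
    (ℕ.>⇒∤ (s≤s (s≤s z≤n)))
  where
  f : Fin (suc h) → Fin (suc h)
  f i = proj₁ (reciprocal pp i)
  involutive : ∀ i → f (f i) ≡ i
  involutive i = reciprocal-unique pp {f i} (proj₂ (reciprocal pp (f i)))
    (≈-trans (≈-reflexive (ℤ.*-comm (rep pp (f i) * rep pp (f i)) (rep pp i * rep pp i)))
      (proj₂ (reciprocal pp i)))
  fixed : ¬ UnitSquare _ -1ℤ → ∀ i → f i ≡ i → i ≡ zero
  fixed ¬sq i fi≡i
    with self-reciprocal pp {i}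
      (subst (λ j → rep pp i * rep pp i * (rep pp j * rep pp j) ≈[ _ ] 1ℤ) fi≡i
        (proj₂ (reciprocal pp i)))
  ... | inj₁ e = rep²-injective pp {i} {zero} e
  ... | inj₂ q = contradiction q ¬sq
  f0≡0 : f zero ≡ zero
  f0≡0 = reciprocal-unique pp {zero} {f zero} {zero} (proj₂ (reciprocal pp zero)) ≈-refl
  even : ¬ UnitSquare _ -1ℤ → 2 ℕ.∣ h
  -- Inside this clause p = 2(h + 1) + 1. The index `zero` stands for 1, the only fixed point, so
  -- `tabulate suc` lists the h indices that are moved.
  even ¬sq = even-length f involutive h (tabulate suc) (length-tabulate suc)
    (Unique.tabulate⁺ suc-injective) closed moves
    where
    closed : ∀ {i} → i ∈ˡ tabulate suc → f i ∈ˡ tabulate suc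
    closed {i} i∈ with f i in eq
    ... | suc j = ∈-tabulate⁺ {f = suc} j
    ... | zero with j , refl ← ∈-tabulate⁻ {f = suc} i∈ =
      contradiction (trans (sym f0≡0) (trans (cong f (sym eq)) (involutive (suc j)))) λ ()
    moves : ∀ {i} → i ∈ˡ tabulate suc → f i ≢ i
    moves i∈ fi≡i with j , refl ← ∈-tabulate⁻ {f = suc} i∈ =
      contradiction (fixed ¬sq (suc j) fi≡i) λ ()

-- Cliques modulo a prime

-- The list gives each difference in one direction; multiplication by the square -1 gives the other.
allPairs⇒clique : ∀ {m r} → UnitSquare m -1ℤ → ∀ {xs} → length xs ≡ r →
  AllPairs (λ x y → UnitSquare m (x - y)) xs → Clique r m
allPairs⇒clique {m} sq {xs} refl adj =
  lookup xs , allPairs-lookup (λ {x} {y} → symmetric {x} {y}) adj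
  where
  symmetric : ∀ {x y} → UnitSquare m (x - y) → UnitSquare m (y - x)
  symmetric {x} {y} q = subst (UnitSquare m) (negate x y) (unitSquare-* sq q)
    where
    negate : ∀ x y → -1ℤ * (x - y) ≡ y - x
    negate = solve-∀

<⇒unit-difference : ∀ {p} → Prime p → ∀ {i j} → i ℕ.< j → j ℕ.< p → Unit p (+ i - + j)
<⇒unit-difference pp i<j j<p = ≉0⇒unit pp λ d≈0 →
  ℕ.<⇒≢ i<j (≈∧<⇒≡ (ℕ.<-trans i<j j<p) j<p (≈-difference d≈0))

module _ {h : ℕ} (pp : Prime (suc (h ℕ.+ h))) (2∣h : 2 ℕ.∣ h) where

  private
    p : ℕ
    p = suc (h ℕ.+ h)

    Square NonSquare : ℤ → ℤ → Set
    Square x y = UnitSquare p (x - y)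
    NonSquare x y = Unit p (x - y) × ¬ UnitSquare p (x - y)

    colour : ∀ {x y} → Unit p (x - y) → Square x y ⊎ NonSquare x y
    colour {x} {y} u = [ inj₁ , (λ ¬q → inj₂ (u , ¬q)) ]′ (toSum (unitSquare? (x - y)))

    sq-1 : UnitSquare p -1ℤ
    sq-1 = unitSquare--1 pp 2∣h

  -- The nonsquare multiplier is taken from the list itself: it is the difference of the first two
  -- elements, which explains the length of at least two.
  nonsquares⇒clique : ∀ {r xs} → length xs ≡ suc (suc r) → AllPairs NonSquare xs →
    Clique (suc (suc r)) p
  nonsquares⇒clique {xs = []} () _
  nonsquares⇒clique {xs = x ∷ []} () _
  nonsquares⇒clique {xs = xs@(x ∷ y ∷ _)} eq adj@(((u , ¬q) ∷ _) ∷ _) =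
    allPairs⇒clique sq-1 {xs = map ((x - y) *_) xs} (trans (length-map ((x - y) *_) xs) eq)
      (AllPairs.map⁺ (AllPairs.map (λ {a} {b} (v , ¬r) →
        subst (UnitSquare p) (distrib (x - y) a b)
          (nonsquare-* {h} pp {x - y} {a - b} u v ¬q ¬r)) adj))
    where
    distrib : ∀ c a b → c * (a - b) ≡ c * a - c * b
    distrib = solve-∀

  p≥20⇒clique : 20 ℕ.≤ p → Clique 4 p
  p≥20⇒clique 20≤p = [ (λ (_ , _ , eq , adj) → allPairs⇒clique sq-1 eq adj) ,
                       (λ (_ , _ , eq , adj) → nonsquares⇒clique eq adj) ]′
    -- `ramseyBound 3 3` evaluates to C(6,3) = 20, the number of integers supplied.
    (ramsey {R = Square} {B = NonSquare} 3 3 {applyUpTo +_ 20} ℕ.≤-refl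
      (AllPairs.applyUpTo⁺₁ +_ 20 λ {i} {j} i<j j<20 →
        colour {+ i} {+ j} (<⇒unit-difference pp i<j (ℕ.<-≤-trans j<20 20≤p))))

-- Exceptional primes, prime powers and the passage to n

%4≡1⇒≡1+2h : ∀ {p} → p % 4 ≡ 1 → ∃ λ h → p ≡ suc (h ℕ.+ h) × 2 ℕ.∣ h
%4≡1⇒≡1+2h {p} eq =
  p / 4 ℕ.* 2 , trans (m≡m%n+[m/n]*n p 4) (cong₂ ℕ._+_ eq (double (p / 4))) , ℕ.n∣m*n (p / 4)
  where
  double : ∀ q → q ℕ.* 4 ≡ q ℕ.* 2 ℕ.+ q ℕ.* 2
  double = ℕ-Solver.solve-∀

Exceptional : ℕ → Set
Exceptional p = p ≡ 5 ⊎ p ≡ 13 ⊎ p ≡ 17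

exceptional? : ∀ p → Dec (Exceptional p)
exceptional? p = (p ℕ.≟ 5) ⊎-dec (p ℕ.≟ 13) ⊎-dec (p ℕ.≟ 17)

<20⇒exceptional : ∀ {p} → p ℕ.< 20 → Prime p → p % 4 ≡ 1 → Exceptional p
<20⇒exceptional = from-yes
  (ℕ.allUpTo? (λ p → prime? p →-dec ((p % 4 ℕ.≟ 1) →-dec exceptional? p)) 20)

clique-mod-prime : ∀ {p} → Prime p → p % 4 ≡ 1 → ¬ Exceptional p → Clique 4 p
clique-mod-prime {p} pp p%4≡1 ¬exc
  with %4≡1⇒≡1+2h {p} p%4≡1
... | h , refl , 2∣h = p≥20⇒clique pp 2∣h (ℕ.≮⇒≥ λ p<20 → ¬exc (<20⇒exceptional p<20 pp p%4≡1))

-- Newton's square root divides by 2. The values 0 and 2 of p drop out by their remainder modulo 4.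
unit-2 : ∀ {p} → Prime p → p % 4 ≡ 1 → Unit p (+ 2)
unit-2 {1} pp _ = contradiction pp ¬prime[1]
unit-2 {suc (suc (suc _))} pp _ = 0<r<p⇒unit pp 2 (s≤s (s≤s (s≤s z≤n)))

exceptional⇒¬clique : ∀ {p} → Exceptional p → ¬ Clique 4 p
exceptional⇒¬clique (inj₁ refl)        = K₄-free⇒¬clique K₄-free-5
exceptional⇒¬clique (inj₂ (inj₁ refl)) = K₄-free⇒¬clique K₄-free-13
exceptional⇒¬clique (inj₂ (inj₂ refl)) = K₄-free⇒¬clique K₄-free-17

clique-mod-prime-power : ∀ {p a} → Prime p → p % 4 ≡ 1 → ¬ Exceptional p → a ≥ 1 → Clique 4 (p ^ a)
clique-mod-prime-power {a = suc a} pp p%4≡1 ¬exc _ =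
  clique-^ a (unit-2 pp p%4≡1) (clique-mod-prime pp p%4≡1 ¬exc)

corollary1p7 :
    ∀ (n k : ℕ) (p α : Fin k → ℕ) →
    k ≥ 1 →
    (∀ i → α i ≥ 1) →
    (∀ i → Prime (p i)) →
    Injective _≡_ _≡_ p →
    (∀ i → p i % 4 ≡ 1) →
    n ≡ product (tabulate (λ i → p i ^ α i)) →
    (𝒦 4 (G n) ≡ 0) ⇔ (∃ λ i → p i ≡ 5 ⊎ p i ≡ 13 ⊎ p i ≡ 17)
corollary1p7 n k p α k≥1 α≥1 prime p-injective p%4≡1 refl = mk⇔ to from
  where
  p∣n : ∀ i → p i ℕ.∣ n
  p∣n i = ℕ.∣-trans (p∣p^ (α≥1 i)) (∣product i)
    where
    p∣p^ : ∀ {q a} → a ≥ 1 → q ℕ.∣ q ^ a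
    p∣p^ {q} {suc a} _ = ℕ.m∣m*n (q ^ a)

  n≢0 : NonZero n
  n≢0 = product≢0 (All.tabulate⁺ λ i → ℕ.m^n≢0 (p i) (α i) {{prime⇒nonZero (prime i)}})

  2≤n : 2 ℕ.≤ n
  2≤n = ℕ.≤-trans (ℕ.nonTrivial⇒n>1 (p i) {{prime⇒nonTrivial (prime i)}})
      (ℕ.∣⇒≤ {{n≢0}} (p∣n i))
    -- `k≥1` supplies a prime factor, which rules out the empty product n = 1.
    where i = fromℕ< k≥1

  embedded⇔clique = embeddedClique⇔clique {4} 2≤n

  powers-coprime : ∀ {i j} → i ≢ j → Coprime (p i ^ α i) (p j ^ α j)
  powers-coprime {i} {j} i≢j = coprime-^ (α j) (Coprime.sym
    (coprime-^ (α i) (Coprime.sym (primes-coprime (prime i) (prime j) (i≢j ∘ p-injective)))))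

  to : 𝒦 4 (G n) ≡ 0 → ∃ (Exceptional ∘ p)
  to 𝒦≡0 with any? (exceptional? ∘ p)
  ... | yes e  = e
  ... | no  ¬e = contradiction
    (Equivalence.from embedded⇔clique (clique-product k powers-coprime λ i →
      clique-mod-prime-power (prime i) (p%4≡1 i) (λ e → ¬e (i , e)) (α≥1 i)))
    (Equivalence.to (𝒦≡0⇔¬clique 4 (G n)) 𝒦≡0)

  from : ∃ (Exceptional ∘ p) → 𝒦 4 (G n) ≡ 0
  from (i , e) = Equivalence.from (𝒦≡0⇔¬clique 4 (G n)) λ c →
    exceptional⇒¬clique e (clique-∣ (ℤ∣.∣ᵤ⇒∣ (p∣n i)) (Equivalence.to embedded⇔clique c))
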